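{- Let $G$ be a graph and $F_1,F_2\in M(\mathcal{G})$. The product of $Z_{F_1}$ and $Z_{F_2}$ in $H(\mathcal{G})^{\ast}$ is given by $$Z_{F_1}Z_{F_2}=\sum_{F\in M(\mathcal{G})}n(F_1,F_2;F)\,Z_F,$$ where $n(F_1,F_2;F)$ is the number of occurrences of $F_1\otimes F_2$ in $\Delta_G(F)$.
   Context: $\mathbf{k}$ is a unitary commutative ring; tensor products and linear maps are over $\mathbf{k}$. Graphs are finite, connected, undirected, without multiple edges and loops (induced subgraphs of them may be disconnected). $G$ is a graph whose vertices are labelled by distinct natural numbers. $\mathcal{G}$ is the set of nonempty connected subgraphs of $G$ (a subgraph is a graph all of whose vertices lie in $V(G)$ and all of whose edges lie in $E(G)$). $M(\mathcal{G})$ is the free (noncommutative) monoid on $\mathcal{G}$, with multiplication given by concatenation and unit the empty graph $\mathbf{1}$. $H(\mathcal{G})=\mathbf{k}M(\mathcal{G})$ is the free $\mathbf{k}$-module on $M(\mathcal{G})$, with multiplication extended linearly. For $\Gamma\in\mathcal{G}$ and $U\subseteq V(\Gamma)$, $\Gamma[U]$ is the subgraph of $\Gamma$ induced by $U$, viewed as an element of $M(\mathcal{G})$: it is the product of its connected components, written in increasing order of their smallest labels, and $\Gamma[\emptyset]=\mathbf{1}$. The coproduct $\Delta_G:H(\mathcal{G})\to H(\mathcal{G})\otimes H(\mathcal{G})$ is the linear map given for $F=\Gamma_1\cdots\Gamma_n\in M(\mathcal{G})$, $\Gamma_i\in\mathcal{G}$, by $$\Delta_G(F)=\sum_{U_i\sqcup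 V_i=V(\Gamma_i),\ i=1,\dots,n}\Gamma_1[U_1]\cdots\Gamma_n[U_n]\otimes\Gamma_1[V_1]\cdots\Gamma_n[V_n],$$ with $\Delta_G(\mathbf{1})=\mathbf{1}\otimes\mathbf{1}$. The number of occurrences of $F_1\otimes F_2$ in $\Delta_G(F)$ is the number of terms of this sum equal to $F_1\otimes F_2$. For $F=\Gamma_1\cdots\Gamma_m$ let $|V(F)|=\sum_i|V(\Gamma_i)|$ and let $H(\mathcal{G})^{(n)}$ be the $\mathbf{k}$-span of all $F\in M(\mathcal{G})$ with $|V(F)|=n$; it has finite rank. The graded dual is $H(\mathcal{G})^{\ast}=\bigoplus_{n\ge0}(H(\mathcal{G})^{(n)})^{\ast}$. For $F\in M(\mathcal{G})$, $Z_F:H(\mathcal{G})\to\mathbf{k}$ is the linear map with $Z_F(F')=\delta_{F,F'}$ for $F'\in M(\mathcal{G})$; the $Z_F$ form a basis of $H(\mathcal{G})^{\ast}$. The product on $H(\mathcal{G})^{\ast}$ is the dual $\Delta_G^{\ast}$ of the coproduct: $(\alpha\beta)(x)=(\alpha\otimes\beta)(\Delta_G(x))$ for $\alpha,\beta\in H(\mathcal{G})^{\ast}$, $x\in H(\mathcal{G})$. -}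

module Defs where

open import Level using (_⊔_) renaming (zero to 0ℓ)
open import Algebra.Bundles using (CommutativeRing)
open import Algebra.Module.Bundles using (Module)
open import Algebra.Module.Structures.Biased using (module IsModuleFromLeft)
open import Algebra.Module.Morphism.Structures using (IsModuleHomomorphism)
open import Algebra.Module.Construct.TensorUnit using (⟨module⟩)
import Algebra.Definitions.RawMonoid as RawMonoidDefs
import Algebra.Properties.Group as GroupProperties
import Algebra.Properties.Ring as RingProperties
import Relation.Binary.Reasoning.Setoid as SetoidReasoning
open import Data.Bool.Base using (if_then_else_)
import Data.Bool.Properties as Bool
open import Data.Fin.Base using (Fin)
import Data.Fin.Properties as Fin
open import Data.Fin.Subset using (Subset; inside; outside; _∩_; ∣_∣; Nonempty)
  renaming (_∈_ to _∈ˢ_)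
open import Data.Fin.Subset.Properties using (_∈?_; x∈p∩q⁺; x∈p∩q⁻; x∈p∪q⁺; p⊆q⇒∣p∣≤∣q∣; ∣⊥∣≡0)
import Data.Fin.Subset as Subset
open import Data.List.Base
  using (List; []; _∷_; _++_; map; mapMaybe; filter; length; foldr; allFin; cartesianProductWith)
open import Data.List.Membership.Propositional using (_∈_)
open import Data.List.Membership.Propositional.Properties
  using (∈-allFin; ∈-cartesianProductWith⁻; ∈-map⁻; ∈-++⁻)
open import Data.List.Properties using (map-++)
import Data.List.Properties as List
open import Data.List.Relation.Binary.Permutation.Propositional using (↭-sym)
open import Data.List.Relation.Binary.Permutation.Propositional.Properties using (∈-resp-↭)
open import Data.List.Relation.Unary.Any using (here; there)
import Data.List.Sort as Sort
open import Data.Maybe.Base using (Maybe; just; nothing)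
open import Data.Nat.Base as ℕ using (ℕ; zero; suc; z≤n; s≤s)
import Data.Nat.Induction as ℕ
open import Data.Nat.ListAction using () renaming (sum to sumℕ)
open import Data.Nat.ListAction.Properties using (sum-++)
import Data.Nat.Properties as ℕ
open import Data.Product.Base using (∃; _×_; _,_; proj₁; proj₂)
open import Data.Product.Properties using () renaming (≡-dec to ×-≡-dec)
open import Data.Sum.Base using (_⊎_; inj₁; inj₂; [_,_]′)
open import Data.Vec.Base using (Vec; []; _∷_; tabulate; lookup)
open import Data.Vec.Properties using ([]=⇒lookup; lookup⇒[]=; lookup∘tabulate)
  renaming (≡-dec to Vec-≡-dec)
open import Function.Base using (_∘_; flip; id)
open import Function.Definitions using (Injective)
open import Induction.WellFounded using (Acc; acc)
import Relation.Binary.Construct.On as On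
open import Relation.Binary.Construct.Closure.ReflexiveTransitive using (Star; ε; _◅_; _◅◅_; reverse)
open import Relation.Binary.Core using (Rel)
open import Relation.Binary.Definitions using (Decidable; DecidableEquality)
open import Relation.Binary.PropositionalEquality
  using (_≡_; refl; sym; trans; cong; cong₂; subst)
open import Relation.Nullary.Decidable
  using (yes; no; does; recompute; map′; _×-dec_; _⊎-dec_; _→-dec_; dec-true)
open import Relation.Nullary.Negation using (¬_; contradiction)
open import Relation.Unary using (Pred) renaming (Decidable to Decidable₁)

module _ {n : ℕ} where

  ⟨_⟩ : ∀ {p} {P : Pred (Fin n) p} → Decidable₁ P → Subset n
  ⟨ P? ⟩ = tabulate (does ∘ P?)

  ∈⟨⟩⁺ : ∀ {p} {P : Pred (Fin n) p} (P? : Decidable₁ P) {x} → P x → x ∈ˢ ⟨ P? ⟩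
  ∈⟨⟩⁺ P? {x} px = lookup⇒[]= x _ (trans (lookup∘tabulate (does ∘ P?) x) (dec-true (P? x) px))

  ∈⟨⟩⁻ : ∀ {p} {P : Pred (Fin n) p} (P? : Decidable₁ P) {x} → x ∈ˢ ⟨ P? ⟩ → P x
  ∈⟨⟩⁻ P? {x} x∈ with P? x | trans (sym (lookup∘tabulate (does ∘ P?) x)) ([]=⇒lookup x∈)
  ... | yes px | _ = px

-- All pairs (U , V) with U ⊔ V = W, each exactly once.

bipartitions : ∀ {n} → Subset n → List (Subset n × Subset n)
bipartitions []            = ([] , []) ∷ []
bipartitions (outside ∷ W) = map (λ (U , V) → outside ∷ U , outside ∷ V) (bipartitions W)
bipartitions (inside  ∷ W) = map (λ (U , V) → inside  ∷ U , outside ∷ V) (bipartitions W)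
                          ++ map (λ (U , V) → outside ∷ U , inside  ∷ V) (bipartitions W)

bipartitions-size : ∀ {n} (W : Subset n) {U V} →
                    (U , V) ∈ bipartitions W → ∣ U ∣ ℕ.+ ∣ V ∣ ≡ ∣ W ∣
bipartitions-size [] (here refl) = refl
bipartitions-size (outside ∷ W) m with ∈-map⁻ _ m
... | _ , m′ , refl = bipartitions-size W m′
bipartitions-size (inside ∷ W) m
  with ∈-++⁻ (map (λ (U , V) → inside ∷ U , outside ∷ V) (bipartitions W)) m
... | inj₁ m₁ with ∈-map⁻ _ m₁
...   | _ , m′ , refl = cong suc (bipartitions-size W m′)
bipartitions-size (inside ∷ W) m | inj₂ m₂ with ∈-map⁻ _ m₂
...   | (U , V) , m′ , refl = trans (ℕ.+-suc ∣ U ∣ ∣ V ∣) (cong suc (bipartitions-size W m′))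

bipartitions-⊆ : ∀ {n} (W : Subset n) {U V} → (U , V) ∈ bipartitions W →
                 ∣ W ∩ U ∣ ≡ ∣ U ∣ × ∣ W ∩ V ∣ ≡ ∣ V ∣
bipartitions-⊆ [] (here refl) = refl , refl
bipartitions-⊆ (outside ∷ W) m with ∈-map⁻ _ m
... | _ , m′ , refl = bipartitions-⊆ W m′
bipartitions-⊆ (inside ∷ W) m
  with ∈-++⁻ (map (λ (U , V) → inside ∷ U , outside ∷ V) (bipartitions W)) m
... | inj₁ m₁ with ∈-map⁻ _ m₁
...   | _ , m′ , refl with bipartitions-⊆ W m′
...     | p , q = cong suc p , q
bipartitions-⊆ (inside ∷ W) m | inj₂ m₂ with ∈-map⁻ _ m₂
...   | _ , m′ , refl with bipartitions-⊆ W m′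
...     | p , q = p , cong suc q

∣∪∣≤ : ∀ {n} (p q : Subset n) → ∣ p Subset.∪ q ∣ ℕ.≤ ∣ p ∣ ℕ.+ ∣ q ∣
∣∪∣≤ []            []            = z≤n
∣∪∣≤ (outside ∷ p) (outside ∷ q) = ∣∪∣≤ p q
∣∪∣≤ (outside ∷ p) (inside  ∷ q) rewrite ℕ.+-suc ∣ p ∣ ∣ q ∣ = s≤s (∣∪∣≤ p q)
∣∪∣≤ (inside  ∷ p) (outside ∷ q) = s≤s (∣∪∣≤ p q)
∣∪∣≤ (inside  ∷ p) (inside  ∷ q) rewrite ℕ.+-suc ∣ p ∣ ∣ q ∣ = s≤s (ℕ.m≤n⇒m≤1+n (∣∪∣≤ p q))

module Reachability {n : ℕ} {E : Rel (Fin n) 0ℓ} (E? : Decidable E) where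

  -- A path all of whose interior vertices lie in the given list.
  Via : List (Fin n) → Rel (Fin n) 0ℓ
  Via []       x y = x ≡ y ⊎ E x y
  Via (z ∷ zs) x y = Via zs x y ⊎ (Via zs x z × Via zs z y)

  via? : ∀ zs → Decidable (Via zs)
  via? []       x y = (x Fin.≟ y) ⊎-dec E? x y
  via? (z ∷ zs) x y = via? zs x y ⊎-dec (via? zs x z ×-dec via? zs z y)

  via⇒star : ∀ zs {x y} → Via zs x y → Star E x y
  via⇒star []       (inj₁ refl)    = ε
  via⇒star []       (inj₂ e)       = e ◅ ε
  via⇒star (z ∷ zs) (inj₁ p)       = via⇒star zs p
  via⇒star (z ∷ zs) (inj₂ (p , q)) = via⇒star zs p ◅◅ via⇒star zs q

  via-trans : ∀ zs {x y z} → z ∈ zs → Via zs x z → Via zs z y → Via zs x y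
  via-trans (z ∷ zs) (here refl) p q = inj₂ ([ id , proj₁ ]′ p , [ id , proj₂ ]′ q)
  via-trans (_ ∷ zs) (there m) (inj₁ p)       (inj₁ q)       = inj₁ (via-trans zs m p q)
  via-trans (_ ∷ zs) (there m) (inj₁ p)       (inj₂ (q , r)) = inj₂ (via-trans zs m p q , r)
  via-trans (_ ∷ zs) (there m) (inj₂ (p , q)) (inj₁ r)       = inj₂ (p , via-trans zs m q r)
  via-trans (_ ∷ zs) (there m) (inj₂ (p , _)) (inj₂ (_ , r)) = inj₂ (p , r)

  via-[] : ∀ zs {x y} → Via [] x y → Via zs x y
  via-[] []       p = p
  via-[] (z ∷ zs) p = inj₁ (via-[] zs p)

  star⇒via : ∀ {x y} → Star E x y → Via (allFin n) x y
  star⇒via ε        = via-[] (allFin n) (inj₁ refl)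
  star⇒via (e ◅ es) = via-trans (allFin n) (∈-allFin _) (via-[] (allFin n) (inj₂ e)) (star⇒via es)

  star? : Decidable (Star E)
  star? x y = map′ (via⇒star (allFin n)) star⇒via (via? (allFin n) x y)

-- A vertex is an index x : Fin order; its label is the natural number label x.

record Graph : Set where
  field
    order           : ℕ
    label           : Fin order → ℕ
    label-injective : Injective _≡_ _≡_ label
    neighbours      : Fin order → Subset order

  _~_ : Rel (Fin order) 0ℓ
  x ~ y = y ∈ˢ neighbours x

  field
    ~-sym     : ∀ {x y} → x ~ y → y ~ x
    ~-irrefl  : ∀ {x} → ¬ (x ~ x)
    connected : ∀ x y → Star _~_ x y

module _ (G : Graph) where
  open Graph G using (order; label; label-injective)

  -- Row x of edges is the set of neighbours of x in the subgraph.  The laws are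
  -- irrelevant, so _≡_ on subgraphs is equality of vertex set and edge set.

  record Subgraph : Set where
    field
      vertices   : Subset order
      edges      : Vec (Subset order) order
      .edges-sym : ∀ {x y} → y ∈ˢ lookup edges x → x ∈ˢ lookup edges y
      .edges⊆V   : ∀ {x y} → y ∈ˢ lookup edges x → x ∈ˢ vertices
      .edges⊆G   : ∀ {x y} → y ∈ˢ lookup edges x → Graph._~_ G x y

    Adj : Rel (Fin order) 0ℓ
    Adj x y = y ∈ˢ lookup edges x

    Adj? : Decidable Adj
    Adj? x y = y ∈? lookup edges x

    open Reachability Adj? public using () renaming (star? to reachable?)

    IsConnected : Set
    IsConnected = ∀ x y → x ∈ˢ vertices → y ∈ˢ vertices → Star Adj x y

  open Subgraph

  Adj-sym : ∀ Γ {x y} → Adj Γ x y → Adj Γ y x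
  Adj-sym Γ@record{ edges-sym = h } {x} {y} e = recompute (Adj? Γ y x) (h e)

  Adj-∈V : ∀ Γ {x y} → Adj Γ x y → x ∈ˢ vertices Γ
  Adj-∈V Γ@record{ edges⊆V = h } {x} e = recompute (x ∈? vertices Γ) (h e)

  Adj-∈G : ∀ Γ {x y} → Adj Γ x y → Graph._~_ G x y
  Adj-∈G record{ edges⊆G = h } {x} {y} e = recompute (y ∈? Graph.neighbours G x) (h e)

  record 𝒢 : Set where
    field
      graph      : Subgraph
      .nonempty  : Nonempty (vertices graph)
      .connected : IsConnected graph

  open 𝒢

  infix 4 _≟ˢ_ _≟ᴳ_ _≟ᴹ_

  _≟ˢ_ : DecidableEquality Subgraph
  Γ ≟ˢ Γ′ with Vec-≡-dec Bool._≟_ (vertices Γ) (vertices Γ′)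
             | Vec-≡-dec (Vec-≡-dec Bool._≟_) (edges Γ) (edges Γ′)
  ... | yes refl | yes refl = yes refl
  ... | no V≢V′  | _        = no (V≢V′ ∘ cong vertices)
  ... | yes _    | no E≢E′  = no (E≢E′ ∘ cong edges)

  _≟ᴳ_ : DecidableEquality 𝒢
  Γ ≟ᴳ Γ′ with graph Γ ≟ˢ graph Γ′
  ... | yes refl = yes refl
  ... | no Γ≢Γ′  = no (Γ≢Γ′ ∘ cong graph)

  M : Set
  M = List 𝒢

  _≟ᴹ_ : DecidableEquality M
  _≟ᴹ_ = List.≡-dec _≟ᴳ_

  ∣V_∣ : M → ℕ
  ∣V F ∣ = sumℕ (map (λ Γ → ∣ vertices (graph Γ) ∣) F)

  module _ (Γ : Subgraph) (U : Subset order) where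

    private
      W : Subset order
      W = vertices Γ ∩ U

      IndAdj : Rel (Fin order) 0ℓ
      IndAdj x y = Adj Γ x y × x ∈ˢ W × y ∈ˢ W

      IndAdj? : Decidable IndAdj
      IndAdj? x y = Adj? Γ x y ×-dec ((x ∈? W) ×-dec (y ∈? W))

      rows : Vec (Subset order) order
      rows = tabulate (λ x → ⟨ IndAdj? x ⟩)

      row⁻ : ∀ {x y} → y ∈ˢ lookup rows x → IndAdj x y
      row⁻ {x} {y} m = ∈⟨⟩⁻ (IndAdj? x) (subst (y ∈ˢ_) (lookup∘tabulate (λ x → ⟨ IndAdj? x ⟩) x) m)

      row⁺ : ∀ {x y} → IndAdj x y → y ∈ˢ lookup rows x
      row⁺ {x} {y} m = subst (y ∈ˢ_) (sym (lookup∘tabulate (λ x → ⟨ IndAdj? x ⟩) x)) (∈⟨⟩⁺ (IndAdj? x) m)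

    induced : Subgraph
    induced = record
      { vertices  = vertices Γ ∩ U
      ; edges     = tabulate (λ x → ⟨ IndAdj? x ⟩)
      ; edges-sym = λ m → let e , x∈ , y∈ = row⁻ m in row⁺ (Adj-sym Γ e , y∈ , x∈)
      ; edges⊆V   = λ m → proj₁ (proj₂ (row⁻ m))
      ; edges⊆G   = λ m → Adj-∈G Γ (proj₁ (row⁻ m))
      }

    induced-adj : ∀ {x y} → Adj Γ x y → x ∈ˢ vertices Γ ∩ U → y ∈ˢ vertices Γ ∩ U → Adj induced x y
    induced-adj e x∈ y∈ = row⁺ (e , x∈ , y∈)

  module _ (Γ : Subgraph) where

    componentOf : ∀ v → v ∈ˢ vertices Γ → 𝒢
    componentOf v v∈ = record
      { graph     = induced Γ R
      ; nonempty  = v , x∈p∩q⁺ (v∈ , ∈⟨⟩⁺ (reachable? Γ v) ε)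
      ; connected = λ x y x∈ y∈ →
          reverse (Adj-sym (induced Γ R)) (inside-R ε (reach x∈)) ◅◅ inside-R ε (reach y∈)
      }
      where
      R : Subset order
      R = ⟨ reachable? Γ v ⟩

      reach : ∀ {x} → x ∈ˢ vertices Γ ∩ R → Star (Adj Γ) v x
      reach x∈ = ∈⟨⟩⁻ (reachable? Γ v) (proj₂ (x∈p∩q⁻ _ _ x∈))

      inside-R : ∀ {a b} → Star (Adj Γ) v a → Star (Adj Γ) a b → Star (Adj (induced Γ R)) a b
      inside-R va ε        = ε
      inside-R va (e ◅ es) =
        induced-adj Γ R e (x∈p∩q⁺ (Adj-∈V Γ e , ∈⟨⟩⁺ (reachable? Γ v) va))
                          (x∈p∩q⁺ (Adj-∈V Γ (Adj-sym Γ e) , ∈⟨⟩⁺ (reachable? Γ v) (va ◅◅ e ◅ ε)))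
        ◅ inside-R (va ◅◅ e ◅ ε) es

    -- v carries the smallest label of its connected component.

    IsRoot : Fin order → Set
    IsRoot v = v ∈ˢ vertices Γ × (∀ w → Star (Adj Γ) v w → label v ℕ.≤ label w)

    isRoot? : Decidable₁ IsRoot
    isRoot? v = (v ∈? vertices Γ) ×-dec Fin.all? (λ w → reachable? Γ v w →-dec (label v ℕ.≤? label w))

    rootedAt : Fin order → Maybe 𝒢
    rootedAt v with isRoot? v
    ... | yes (v∈ , _) = just (componentOf v v∈)
    ... | no _         = nothing

  open Sort (On.decTotalOrder ℕ.≤-decTotalOrder label) using (sort; sort-↭)

  -- Each component is listed at its smallest-labelled vertex, in increasing order of label.

  components : Subgraph → M
  components Γ = mapMaybe (rootedAt Γ) (sort (allFin order))

  infix 10 _[_]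

  _[_] : 𝒢 → Subset order → M
  Γ [ U ] = components (induced (graph Γ) U)

  -- The pairs (A , B) for the terms A ⊗ B of the coproduct of F, with repetition.

  Δ-terms : M → List (M × M)
  Δ-terms []      = ([] , []) ∷ []
  Δ-terms (Γ ∷ F) = cartesianProductWith
    (λ (U , V) (A , B) → Γ [ U ] ++ A , Γ [ V ] ++ B)
    (bipartitions (vertices (graph Γ))) (Δ-terms F)

  -- The terms of Δ-terms F are compared as pairs of words.

  occurrences : M → M → M → ℕ
  occurrences F₁ F₂ F = length (filter (×-≡-dec _≟ᴹ_ _≟ᴹ_ (F₁ , F₂)) (Δ-terms F))

  private
    ∈-mapMaybe : ∀ {a b} {A : Set a} {B : Set b} (f : A → Maybe B) {x y} xs →
                 x ∈ xs → f x ≡ just y → y ∈ mapMaybe f xs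
    ∈-mapMaybe f (x ∷ xs) (here refl) eq with just _ ← f x | refl ← eq = here refl
    ∈-mapMaybe f (x ∷ xs) (there m)   eq with f x
    ... | just _  = there (∈-mapMaybe f xs m eq)
    ... | nothing = ∈-mapMaybe f xs m eq

    reach-∈V : ∀ Γ {x y} → x ∈ˢ vertices Γ → Star (Adj Γ) x y → y ∈ˢ vertices Γ
    reach-∈V Γ x∈ ε        = x∈
    reach-∈V Γ x∈ (e ◅ es) = reach-∈V Γ (Adj-∈V Γ (Adj-sym Γ e)) es

    root : ∀ Γ w → w ∈ˢ vertices Γ → Acc ℕ._<_ (label w) → ∃ λ v → IsRoot Γ v × Star (Adj Γ) w v
    root Γ w w∈ (acc rec)
      with Fin.any? (λ u → reachable? Γ w u ×-dec (label u ℕ.<? label w))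
    ... | yes (u , p , u<w) =
          let v , r , q = root Γ u (reach-∈V Γ w∈ p) (rec u<w) in v , r , p ◅◅ q
    ... | no ∄u = w , (w∈ , λ u p → ℕ.≮⇒≥ (λ u<w → ∄u (u , p , u<w))) , ε

    rootedAt-∋ : ∀ Γ {v w} → IsRoot Γ v → Star (Adj Γ) v w →
                 ∃ λ C → rootedAt Γ v ≡ just C × w ∈ˢ vertices (graph C)
    rootedAt-∋ Γ {v} r p with isRoot? Γ v
    ... | yes (v∈ , _) = _ , refl , x∈p∩q⁺ (reach-∈V Γ v∈ p , ∈⟨⟩⁺ (reachable? Γ v) p)
    ... | no ¬r        = contradiction r ¬r

    components-∋ : ∀ Γ {w} → w ∈ˢ vertices Γ → ∃ λ C → C ∈ components Γ × w ∈ˢ vertices (graph C)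
    components-∋ Γ {w} w∈ =
      let v , r , p    = root Γ w w∈ (ℕ.<-wellFounded _)
          C , eq , w∈C = rootedAt-∋ Γ r (reverse (Adj-sym Γ) p)
      in C , ∈-mapMaybe (rootedAt Γ) _ (∈-resp-↭ (↭-sym (sort-↭ (allFin order))) (∈-allFin v)) eq , w∈C

    union-bound : ∀ F (W : Subset order) →
                  (∀ {w} → w ∈ˢ W → ∃ λ C → C ∈ F × w ∈ˢ vertices (graph C)) → ∣ W ∣ ℕ.≤ ∣V F ∣
    union-bound F W cover = ℕ.≤-trans (p⊆q⇒∣p∣≤∣q∣ (λ w∈ → let C , m , w∈C = cover w∈ in in-⋃ F m w∈C)) (∣⋃∣≤ F)
      where
      ⋃V : M → Subset order
      ⋃V F = Subset.⋃ (map (vertices ∘ graph) F)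

      in-⋃ : ∀ F {C w} → C ∈ F → w ∈ˢ vertices (graph C) → w ∈ˢ ⋃V F
      in-⋃ (C ∷ F) (here refl) w∈ = x∈p∪q⁺ (inj₁ w∈)
      in-⋃ (C ∷ F) (there m)   w∈ = x∈p∪q⁺ (inj₂ (in-⋃ F m w∈))

      ∣⋃∣≤ : ∀ F → ∣ ⋃V F ∣ ℕ.≤ ∣V F ∣
      ∣⋃∣≤ []      = ℕ.≤-reflexive (∣⊥∣≡0 order)
      ∣⋃∣≤ (C ∷ F) = ℕ.≤-trans (∣∪∣≤ (vertices (graph C)) (⋃V F)) (ℕ.+-monoʳ-≤ _ (∣⋃∣≤ F))

    ∣V++∣ : ∀ F F′ → ∣V F ++ F′ ∣ ≡ ∣V F ∣ ℕ.+ ∣V F′ ∣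
    ∣V++∣ F F′ = trans (cong sumℕ (map-++ _ F F′)) (sum-++ (map _ F) _)

    interchange : ∀ a b c d → (a ℕ.+ b) ℕ.+ (c ℕ.+ d) ≡ (a ℕ.+ c) ℕ.+ (b ℕ.+ d)
    interchange = ℕSemigroup.interchange
      where import Algebra.Properties.CommutativeSemigroup ℕ.+-commutativeSemigroup as ℕSemigroup

  ∣V[]∣ : ∀ Γ U → ∣ vertices (graph Γ) ∩ U ∣ ℕ.≤ ∣V Γ [ U ] ∣
  ∣V[]∣ Γ U = union-bound (Γ [ U ]) (vertices (graph Γ) ∩ U) (components-∋ (induced (graph Γ) U))

  Δ-terms-size : ∀ F {A B} → (A , B) ∈ Δ-terms F → ∣V F ∣ ℕ.≤ ∣V A ∣ ℕ.+ ∣V B ∣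
  Δ-terms-size []      (here refl) = z≤n
  Δ-terms-size (Γ ∷ F) m
    with (U , V) , (A , B) , m₁ , m₂ , refl ←
         ∈-cartesianProductWith⁻ (λ (U , V) (A , B) → Γ [ U ] ++ A , Γ [ V ] ++ B)
           (bipartitions (vertices (graph Γ))) (Δ-terms F) m
    = begin
      ∣ W ∣ ℕ.+ ∣V F ∣
        ≡⟨ cong (ℕ._+ ∣V F ∣) (bipartitions-size W m₁) ⟨
      (∣ U ∣ ℕ.+ ∣ V ∣) ℕ.+ ∣V F ∣
        ≡⟨ cong₂ (λ u v → u ℕ.+ v ℕ.+ ∣V F ∣) (proj₁ (bipartitions-⊆ W m₁)) (proj₂ (bipartitions-⊆ W m₁)) ⟨
      (∣ W ∩ U ∣ ℕ.+ ∣ W ∩ V ∣) ℕ.+ ∣V F ∣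
        ≤⟨ ℕ.+-mono-≤ (ℕ.+-mono-≤ (∣V[]∣ Γ U) (∣V[]∣ Γ V)) (Δ-terms-size F m₂) ⟩
      (∣V Γ [ U ] ∣ ℕ.+ ∣V Γ [ V ] ∣) ℕ.+ (∣V A ∣ ℕ.+ ∣V B ∣)
        ≡⟨ interchange ∣V Γ [ U ] ∣ ∣V Γ [ V ] ∣ ∣V A ∣ ∣V B ∣ ⟩
      (∣V Γ [ U ] ∣ ℕ.+ ∣V A ∣) ℕ.+ (∣V Γ [ V ] ∣ ℕ.+ ∣V B ∣)
        ≡⟨ cong₂ ℕ._+_ (∣V++∣ (Γ [ U ]) A) (∣V++∣ (Γ [ V ]) B) ⟨
      ∣V Γ [ U ] ++ A ∣ ℕ.+ ∣V Γ [ V ] ++ B ∣ ∎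
    where
    open ℕ.≤-Reasoning
    W : Subset order
    W = vertices (graph Γ)

module Linear {c ℓ} (k : CommutativeRing c ℓ) where
  open CommutativeRing k
    using (Carrier; _≈_; _+_; _*_; -_; 0#; 1#)
    renaming ( refl to ≈-refl; sym to ≈-sym; trans to ≈-trans
             ; +-cong to +ᵏ-cong; *-cong to *ᵏ-cong; setoid to ≈-setoid )
  module k = CommutativeRing k

  record LinearMap {a ℓa b ℓb} (A : Module k a ℓa) (B : Module k b ℓb)
                   : Set (c ⊔ a ⊔ ℓa ⊔ b ⊔ ℓb) where
    private
      module A = Module A
      module B = Module B
    field
      fun      : A.Carrierᴹ → B.Carrierᴹ
      isLinear : IsModuleHomomorphism A.rawModule B.rawModule fun

    open IsModuleHomomorphism isLinear public
      using (⟦⟧-cong; +ᴹ-homo; *ₗ-homo; 0ᴹ-homo; -ᴹ-homo)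

  open LinearMap public

  module _ {a ℓa b ℓb} {A : Module k a ℓa} {B : Module k b ℓb} where
    private
      module A = Module A
      module B = Module B

    mkLinear : (f : A.Carrierᴹ → B.Carrierᴹ) →
               (∀ {x y} → x A.≈ᴹ y → f x B.≈ᴹ f y) →
               (∀ x y → f (x A.+ᴹ y) B.≈ᴹ f x B.+ᴹ f y) →
               (∀ r x → f (r A.*ₗ x) B.≈ᴹ r B.*ₗ f x) →
               LinearMap A B
    mkLinear f f-cong f-+ f-* = record
      { fun      = f
      ; isLinear = record { isBimoduleHomomorphism = record
          { +ᴹ-isGroupHomomorphism = record
              { isMonoidHomomorphism = record
                  { isMagmaHomomorphism = record
                      { isRelHomomorphism = record { cong = f-cong } ; homo = f-+ }
                  ; ε-homo = f-0 }
              ; ⁻¹-homo = λ x → GroupProperties.inverseˡ-unique B.+ᴹ-group (f (A.-ᴹ x)) (f x)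
                  (B.≈ᴹ-trans (B.≈ᴹ-sym (f-+ _ _)) (B.≈ᴹ-trans (f-cong (A.-ᴹ‿inverseˡ x)) f-0)) }
          ; *ₗ-homo = f-*
          ; *ᵣ-homo = λ r x → B.≈ᴹ-trans (f-cong (A.≈ᴹ-sym (A.*ₗ-*ᵣ-coincident r x)))
                                (B.≈ᴹ-trans (f-* r x) (B.*ₗ-*ᵣ-coincident r (f x))) } } }
      where
      f-0 : f A.0ᴹ B.≈ᴹ B.0ᴹ
      f-0 = B.≈ᴹ-trans (f-cong (A.≈ᴹ-sym (A.*ₗ-zeroˡ A.0ᴹ))) (B.≈ᴹ-trans (f-* 0# A.0ᴹ) (B.*ₗ-zeroˡ _))

  _∘ᴸ_ : ∀ {a ℓa b ℓb d ℓd} {A : Module k a ℓa} {B : Module k b ℓb} {C : Module k d ℓd} →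
         LinearMap B C → LinearMap A B → LinearMap A C
  _∘ᴸ_ {C = C} g f = mkLinear (fun g ∘ fun f) (⟦⟧-cong g ∘ ⟦⟧-cong f)
    (λ x y → Module.≈ᴹ-trans C (⟦⟧-cong g (+ᴹ-homo f x y)) (+ᴹ-homo g _ _))
    (λ r x → Module.≈ᴹ-trans C (⟦⟧-cong g (*ₗ-homo f r x)) (*ₗ-homo g r _))

  𝐤 : Module k c ℓ
  𝐤 = ⟨module⟩

  -- A module presented by generators X and relations R.

  data Term {x} (X : Set x) : Set (c ⊔ x) where
    gen  : X → Term X
    𝟘    : Term X
    _⊕_  : Term X → Term X → Term X
    _·_  : Carrier → Term X → Term X

  infixl 6 _⊕_
  infixr 7 _·_

  module _ {x r} {X : Set x} (R : Rel (Term X) r) where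

    infix 4 _≋_

    data _≋_ : Rel (Term X) (c ⊔ ℓ ⊔ x ⊔ r) where
      rel         : ∀ {s t} → R s t → s ≋ t
      ≋-refl      : ∀ {t} → t ≋ t
      ≋-sym       : ∀ {s t} → s ≋ t → t ≋ s
      ≋-trans     : ∀ {s t u} → s ≋ t → t ≋ u → s ≋ u
      ⊕-cong      : ∀ {s s′ t t′} → s ≋ s′ → t ≋ t′ → s ⊕ t ≋ s′ ⊕ t′
      ·-cong      : ∀ {a b s t} → a ≈ b → s ≋ t → a · s ≋ b · t
      ⊕-assoc     : ∀ s t u → (s ⊕ t) ⊕ u ≋ s ⊕ (t ⊕ u)
      ⊕-comm      : ∀ s t → s ⊕ t ≋ t ⊕ s
      ⊕-identityˡ : ∀ t → 𝟘 ⊕ t ≋ t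
      ·-zeroˡ     : ∀ t → 0# · t ≋ 𝟘
      ·-identityˡ : ∀ t → 1# · t ≋ t
      ·-assoc     : ∀ a b t → (a * b) · t ≋ a · b · t
      ·-distribˡ  : ∀ a s t → a · (s ⊕ t) ≋ a · s ⊕ a · t
      ·-distribʳ  : ∀ t a b → (a + b) · t ≋ a · t ⊕ b · t

    private
      ·-zeroʳ : ∀ a → a · 𝟘 ≋ 𝟘
      ·-zeroʳ a = ≋-trans (·-cong ≈-refl (≋-sym (·-zeroˡ 𝟘)))
        (≋-trans (≋-sym (·-assoc a 0# 𝟘)) (≋-trans (·-cong (k.zeroʳ a) ≋-refl) (·-zeroˡ 𝟘)))

      inverseʳ : ∀ t → t ⊕ (- 1#) · t ≋ 𝟘
      inverseʳ t = ≋-trans (⊕-cong (≋-sym (·-identityˡ t)) ≋-refl)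
        (≋-trans (≋-sym (·-distribʳ t 1# (- 1#))) (≋-trans (·-cong (k.-‿inverseʳ 1#) ≋-refl) (·-zeroˡ t)))

    presented : Module k (c ⊔ x) (c ⊔ ℓ ⊔ x ⊔ r)
    presented = record
      { Carrierᴹ = Term X
      ; _≈ᴹ_     = _≋_
      ; _+ᴹ_     = _⊕_
      ; _*ₗ_     = _·_
      ; _*ᵣ_     = flip _·_
      ; 0ᴹ       = 𝟘
      ; -ᴹ_      = (- 1#) ·_
      ; isModule = IsModuleFromLeft.isModule {commutativeRing = k} record { isLeftModule = record
          { isLeftSemimodule = record
              { +ᴹ-isCommutativeMonoid = record
                  { isMonoid = record
                      { isSemigroup = record
                          { isMagma = record
                              { isEquivalence = record { refl = ≋-refl ; sym = ≋-sym ; trans = ≋-trans }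
                              ; ∙-cong = ⊕-cong }
                          ; assoc = ⊕-assoc }
                      ; identity = ⊕-identityˡ , λ t → ≋-trans (⊕-comm t 𝟘) (⊕-identityˡ t) }
                  ; comm = ⊕-comm }
              ; isPreleftSemimodule = record
                  { *ₗ-cong      = ·-cong
                  ; *ₗ-zeroˡ     = ·-zeroˡ
                  ; *ₗ-distribʳ  = ·-distribʳ
                  ; *ₗ-identityˡ = ·-identityˡ
                  ; *ₗ-assoc     = ·-assoc
                  ; *ₗ-zeroʳ     = ·-zeroʳ
                  ; *ₗ-distribˡ  = ·-distribˡ } }
          ; -ᴹ‿cong    = ·-cong ≈-refl
          ; -ᴹ‿inverse = (λ t → ≋-trans (⊕-comm _ t) (inverseʳ t)) , inverseʳ } }
      }

    module _ {b ℓb} (B : Module k b ℓb) (f : X → Module.Carrierᴹ B) where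
      private module B = Module B

      eval : Term X → B.Carrierᴹ
      eval (gen x) = f x
      eval 𝟘       = B.0ᴹ
      eval (s ⊕ t) = eval s B.+ᴹ eval t
      eval (a · t) = a B.*ₗ eval t

      -- The linear map determined by its values on generators.

      extend : (∀ {s t} → R s t → eval s B.≈ᴹ eval t) → LinearMap presented B
      extend resp = mkLinear eval eval-cong (λ _ _ → B.≈ᴹ-refl) (λ _ _ → B.≈ᴹ-refl)
        where
        eval-cong : ∀ {s t} → s ≋ t → eval s B.≈ᴹ eval t
        eval-cong (rel p)            = resp p
        eval-cong ≋-refl             = B.≈ᴹ-refl
        eval-cong (≋-sym p)          = B.≈ᴹ-sym (eval-cong p)
        eval-cong (≋-trans p q)      = B.≈ᴹ-trans (eval-cong p) (eval-cong q)
        eval-cong (⊕-cong p q)       = B.+ᴹ-cong (eval-cong p) (eval-cong q)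
        eval-cong (·-cong a p)       = B.*ₗ-cong a (eval-cong p)
        eval-cong (⊕-assoc s t u)    = B.+ᴹ-assoc _ _ _
        eval-cong (⊕-comm s t)       = B.+ᴹ-comm _ _
        eval-cong (⊕-identityˡ t)    = B.+ᴹ-identityˡ _
        eval-cong (·-zeroˡ t)        = B.*ₗ-zeroˡ _
        eval-cong (·-identityˡ t)    = B.*ₗ-identityˡ _
        eval-cong (·-assoc a b t)    = B.*ₗ-assoc a b _
        eval-cong (·-distribˡ a s t) = B.*ₗ-distribˡ a _ _
        eval-cong (·-distribʳ t a b) = B.*ₗ-distribʳ _ a b

  data NoRelation {x} {X : Set x} : Rel (Term X) 0ℓ where

  Free : ∀ {x} → Set x → Module k (c ⊔ x) (c ⊔ ℓ ⊔ x)
  Free X = presented (NoRelation {X = X})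

  extendFree : ∀ {x b ℓb} {X : Set x} (B : Module k b ℓb) → (X → Module.Carrierᴹ B) → LinearMap (Free X) B
  extendFree B f = extend NoRelation B f λ ()

  module _ {a ℓa b ℓb} (A : Module k a ℓa) (B : Module k b ℓb) where
    private
      module A = Module A
      module B = Module B

    data Bilinear : Rel (Term (A.Carrierᴹ × B.Carrierᴹ)) (c ⊔ a ⊔ ℓa ⊔ b ⊔ ℓb) where
      ⊗-cong : ∀ {x x′ y y′} → x A.≈ᴹ x′ → y B.≈ᴹ y′ → Bilinear (gen (x , y)) (gen (x′ , y′))
      ⊗-+ˡ   : ∀ x x′ y → Bilinear (gen (x A.+ᴹ x′ , y)) (gen (x , y) ⊕ gen (x′ , y))
      ⊗-+ʳ   : ∀ x y y′ → Bilinear (gen (x , y B.+ᴹ y′)) (gen (x , y) ⊕ gen (x , y′))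
      ⊗-·ˡ   : ∀ r x y → Bilinear (gen (r A.*ₗ x , y)) (r · gen (x , y))
      ⊗-·ʳ   : ∀ r x y → Bilinear (gen (x , r B.*ₗ y)) (r · gen (x , y))

    infixr 8 _⊗_

    _⊗_ : Module k (c ⊔ a ⊔ b) (c ⊔ ℓ ⊔ a ⊔ ℓa ⊔ b ⊔ ℓb)
    _⊗_ = presented Bilinear

  module _ {a ℓa b ℓb} {A : Module k a ℓa} {B : Module k b ℓb} where
    private
      module A = Module A
      module B = Module B

    infixr 8 _⊗ᴸ_

    -- α ⊗ β followed by the identification 𝐤 ⊗ 𝐤 ≅ 𝐤, r ⊗ s ↦ r * s.

    _⊗ᴸ_ : LinearMap A 𝐤 → LinearMap B 𝐤 → LinearMap (A ⊗ B) 𝐤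
    α ⊗ᴸ β = extend (Bilinear A B) 𝐤 value resp
      where
      open SetoidReasoning ≈-setoid
      value : A.Carrierᴹ × B.Carrierᴹ → Carrier
      value (x , y) = fun α x * fun β y

      resp : ∀ {s t} → Bilinear A B s t → eval (Bilinear A B) 𝐤 value s ≈ eval (Bilinear A B) 𝐤 value t
      resp (⊗-cong p q)    = *ᵏ-cong (⟦⟧-cong α p) (⟦⟧-cong β q)
      resp (⊗-+ˡ x x′ y)   = ≈-trans (k.*-congʳ (+ᴹ-homo α x x′)) (k.distribʳ _ _ _)
      resp (⊗-+ʳ x y y′)   = ≈-trans (k.*-congˡ (+ᴹ-homo β y y′)) (k.distribˡ _ _ _)
      resp (⊗-·ˡ r x y)    = ≈-trans (k.*-congʳ (*ₗ-homo α r x)) (k.*-assoc _ _ _)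
      resp (⊗-·ʳ r x y)    = begin
        fun α x * fun β (r B.*ₗ y) ≈⟨ k.*-congˡ (*ₗ-homo β r y) ⟩
        fun α x * (r * fun β y)    ≈⟨ k.*-assoc _ _ _ ⟨
        (fun α x * r) * fun β y    ≈⟨ k.*-congʳ (k.*-comm _ _) ⟩
        (r * fun α x) * fun β y    ≈⟨ k.*-assoc _ _ _ ⟩
        r * (fun α x * fun β y)    ∎

  module _ {a ℓa} (A : Module k a ℓa) where
    open Module A

    data Span {p} (P : Pred Carrierᴹ p) : Pred Carrierᴹ (c ⊔ a ⊔ ℓa ⊔ p) where
      base : ∀ {x} → P x → Span P x
      zero : Span P 0ᴹ
      add  : ∀ {x y} → Span P x → Span P y → Span P (x +ᴹ y)
      mul  : ∀ r {x} → Span P x → Span P (r *ₗ x)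
      resp : ∀ {x y} → x ≈ᴹ y → Span P x → Span P y

    ∑ : List Carrierᴹ → Carrierᴹ
    ∑ = foldr _+ᴹ_ 0ᴹ

  -- A linear form vanishing on a set vanishes on its span.

  span-vanish : ∀ {a ℓa p} {A : Module k a ℓa} {P : Pred (Module.Carrierᴹ A) p} (α : LinearMap A 𝐤) →
                (∀ {x} → P x → fun α x ≈ 0#) → ∀ {x} → Span A P x → fun α x ≈ 0#
  span-vanish α h (base p)   = h p
  span-vanish α h zero       = 0ᴹ-homo α
  span-vanish α h (add s t)  = ≈-trans (+ᴹ-homo α _ _)
    (≈-trans (+ᵏ-cong (span-vanish α h s) (span-vanish α h t)) (k.+-identityˡ 0#))
  span-vanish α h (mul r s)  = ≈-trans (*ₗ-homo α r _) (≈-trans (k.*-congˡ (span-vanish α h s)) (k.zeroʳ r))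
  span-vanish {A = A} α h (resp e s) = ≈-trans (⟦⟧-cong α (Module.≈ᴹ-sym A e)) (span-vanish α h s)

module HopfDual {c ℓ} (k : CommutativeRing c ℓ) (G : Graph) where
  open CommutativeRing k
    using (Carrier; _≈_; _+_; _*_; -_; 0#; 1#)
    renaming (refl to ≈-refl; sym to ≈-sym; trans to ≈-trans)
  open Linear k

  H : Module k c (c ⊔ ℓ)
  H = Free (M G)

  H⟨_⟩ : ℕ → Pred (Module.Carrierᴹ H) (c ⊔ ℓ)
  H⟨ n ⟩ = Span H (λ x → ∃ λ F → ∣V_∣ G F ≡ n × x ≡ gen F)

  infixr 8 _⊗ᴹ_

  _⊗ᴹ_ : M G → M G → Module.Carrierᴹ (H ⊗ H)
  A ⊗ᴹ B = gen (gen A , gen B)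

  Δ : LinearMap H (H ⊗ H)
  Δ = extendFree (H ⊗ H) λ F → ∑ (H ⊗ H) (map (λ (A , B) → A ⊗ᴹ B) (Δ-terms G F))

  -- An element of the direct sum of the duals of the H⟨ n ⟩ is a linear form on H
  -- that vanishes on H⟨ n ⟩ for all but finitely many n.

  record H* : Set (c ⊔ ℓ) where
    field
      form     : LinearMap H 𝐤
      bound    : ℕ
      vanishes : ∀ n → bound ℕ.≤ n → ∀ {x} → H⟨ n ⟩ x → fun form x ≈ 0#

  open H* public

  δ : M G → M G → Carrier
  δ F F′ = if does (_≟ᴹ_ G F F′) then 1# else 0#

  Z : M G → H*
  Z F = record
    { form     = extendFree 𝐤 (δ F)
    ; bound    = suc (∣V_∣ G F)
    ; vanishes = λ n F<n → span-vanish (extendFree 𝐤 (δ F)) λ { (F′ , eq , refl) → off F<n F′ eq }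
    }
    where
    off : ∀ {n} → ∣V_∣ G F ℕ.< n → ∀ F′ → ∣V_∣ G F′ ≡ n → δ F F′ ≈ 0#
    off F<n F′ eq with _≟ᴹ_ G F F′
    ... | yes refl = contradiction (sym eq) (ℕ.<⇒≢ F<n ∘ sym)
    ... | no _     = ≈-refl

  infixl 7 _✶_

  _✶_ : H* → H* → H*
  α ✶ β = record
    { form     = αβ
    ; bound    = bound α ℕ.+ bound β
    ; vanishes = λ n b≤n → span-vanish αβ λ { (F , eq , refl) →
        vanish-∑ (Δ-terms G F) λ {A} {B} m → vanish-⊗ A B
          (ℕ.≤-trans (subst (bound α ℕ.+ bound β ℕ.≤_) (sym eq) b≤n) (Δ-terms-size G F m)) }
    }
    where
    αβ : LinearMap H 𝐤
    αβ = (form α ⊗ᴸ form β) ∘ᴸ Δ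

    vanish-⊗ : ∀ A B → bound α ℕ.+ bound β ℕ.≤ ∣V_∣ G A ℕ.+ ∣V_∣ G B →
               fun (form α) (gen A) * fun (form β) (gen B) ≈ 0#
    vanish-⊗ A B le with bound α ℕ.≤? ∣V_∣ G A | bound β ℕ.≤? ∣V_∣ G B
    ... | yes a≤ | _      = ≈-trans (k.*-congʳ (vanishes α _ a≤ (base (A , refl , refl)))) (k.zeroˡ _)
    ... | no _   | yes b≤ = ≈-trans (k.*-congˡ (vanishes β _ b≤ (base (B , refl , refl)))) (k.zeroʳ _)
    ... | no a≰  | no b≰  = contradiction le (ℕ.<⇒≱ (ℕ.+-mono-< (ℕ.≰⇒> a≰) (ℕ.≰⇒> b≰)))

    vanish-∑ : ∀ ts → (∀ {A B} → (A , B) ∈ ts → fun (form α) (gen A) * fun (form β) (gen B) ≈ 0#) →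
               fun (form α ⊗ᴸ form β) (∑ (H ⊗ H) (map (λ (A , B) → A ⊗ᴹ B) ts)) ≈ 0#
    vanish-∑ []       h = ≈-refl
    vanish-∑ (_ ∷ ts) h = ≈-trans (k.+-cong (h (here refl)) (vanish-∑ ts (h ∘ there))) (k.+-identityˡ 0#)

  private
    zero* : H*
    zero* = record
      { form     = mkLinear (λ _ → 0#) (λ _ → ≈-refl) (λ _ _ → ≈-sym (k.+-identityˡ 0#)) (λ r _ → ≈-sym (k.zeroʳ r))
      ; bound    = 0
      ; vanishes = λ _ _ _ → ≈-refl
      }

    add* : H* → H* → H*
    add* α β = record
      { form     = mkLinear (λ x → fun (form α) x + fun (form β) x)
                     (λ e → k.+-cong (⟦⟧-cong (form α) e) (⟦⟧-cong (form β) e))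
                     (λ x y → ≈-trans (k.+-cong (+ᴹ-homo (form α) x y) (+ᴹ-homo (form β) x y)) (interchange _ _ _ _))
                     (λ r x → ≈-trans (k.+-cong (*ₗ-homo (form α) r x) (*ₗ-homo (form β) r x)) (≈-sym (k.distribˡ _ _ _)))
      ; bound    = bound α ℕ.⊔ bound β
      ; vanishes = λ n b≤n x∈ → ≈-trans
          (k.+-cong (vanishes α n (ℕ.m⊔n≤o⇒m≤o (bound α) (bound β) b≤n) x∈)
                    (vanishes β n (ℕ.m⊔n≤o⇒n≤o (bound α) (bound β) b≤n) x∈))
          (k.+-identityˡ 0#)
      }
      where open import Algebra.Properties.CommutativeSemigroup k.+-commutativeSemigroup using (interchange)

    scale* : Carrier → H* → H*
    scale* s α = record
      { form     = mkLinear (λ x → s * fun (form α) x)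
                     (λ e → k.*-congˡ (⟦⟧-cong (form α) e))
                     (λ x y → ≈-trans (k.*-congˡ (+ᴹ-homo (form α) x y)) (k.distribˡ _ _ _))
                     (λ r x → ≈-trans (k.*-congˡ (*ₗ-homo (form α) r x)) (x∙yz≈y∙xz s r _))
      ; bound    = bound α
      ; vanishes = λ n b≤n x∈ → ≈-trans (k.*-congˡ (vanishes α n b≤n x∈)) (k.zeroʳ s)
      }
      where open import Algebra.Properties.CommutativeSemigroup k.*-commutativeSemigroup using (x∙yz≈y∙xz)

    inverseʳ* : ∀ a → a + - 1# * a ≈ 0#
    inverseʳ* a = ≈-trans (k.+-congˡ (RingProperties.-1*x≈-x k.ring a)) (k.-‿inverseʳ a)

  H*-module : Module k (c ⊔ ℓ) (c ⊔ ℓ)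
  H*-module = record
    { Carrierᴹ = H*
    ; _≈ᴹ_     = λ α β → ∀ x → fun (form α) x ≈ fun (form β) x
    ; _+ᴹ_     = add*
    ; _*ₗ_     = scale*
    ; _*ᵣ_     = flip scale*
    ; 0ᴹ       = zero*
    ; -ᴹ_      = scale* (- 1#)
    ; isModule = IsModuleFromLeft.isModule {commutativeRing = k} record { isLeftModule = record
        { isLeftSemimodule = record
            { +ᴹ-isCommutativeMonoid = record
                { isMonoid = record
                    { isSemigroup = record
                        { isMagma = record
                            { isEquivalence = record
                                { refl = λ _ → ≈-refl ; sym = λ p x → ≈-sym (p x) ; trans = λ p q x → ≈-trans (p x) (q x) }
                            ; ∙-cong = λ p q x → k.+-cong (p x) (q x) }
                        ; assoc = λ _ _ _ _ → k.+-assoc _ _ _ }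
                    ; identity = (λ _ _ → k.+-identityˡ _) , λ _ _ → k.+-identityʳ _ }
                ; comm = λ _ _ _ → k.+-comm _ _ }
            ; isPreleftSemimodule = record
                { *ₗ-cong      = λ p q x → k.*-cong p (q x)
                ; *ₗ-zeroˡ     = λ _ _ → k.zeroˡ _
                ; *ₗ-distribʳ  = λ _ _ _ _ → k.distribʳ _ _ _
                ; *ₗ-identityˡ = λ _ _ → k.*-identityˡ _
                ; *ₗ-assoc     = λ _ _ _ _ → k.*-assoc _ _ _
                ; *ₗ-zeroʳ     = λ _ _ → k.zeroʳ _
                ; *ₗ-distribˡ  = λ _ _ _ _ → k.distribˡ _ _ _ } }
        ; -ᴹ‿cong    = λ p x → k.*-congˡ (p x)
        ; -ᴹ‿inverse = (λ _ _ → ≈-trans (k.+-comm _ _) (inverseʳ* _)) , λ _ _ → inverseʳ* _ } }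
    }

  open Module H*-module public using () renaming (_≈ᴹ_ to _≈*_)

  open RawMonoidDefs (Module.+ᴹ-rawMonoid H*-module) public using () renaming (_×_ to _·ℕ_)

  ∑* : List H* → H*
  ∑* = ∑ H*-module

{-# OPTIONS --safe #-}
-- A linear form on the free module H is determined by its values on words, and both sides
-- take the value n(F₁,F₂;F) · 1 at F.  The sum is finite: every connected subgraph is
-- nonempty, so an F with n(F₁,F₂;F) ≠ 0 has at most |V(F₁)| + |V(F₂)| factors, each taken
-- from the finite set 𝒢.
module Submission where

open import Defs
open import Algebra.Bundles using (CommutativeRing)
open import Algebra.Module.Bundles using (Module)
import Algebra.Definitions.RawMonoid as RawMonoidDefs
import Algebra.Properties.Monoid.Mult as MonoidMult
import Data.Fin.Properties as Fin
open import Data.Fin.Subset using (Subset; Nonempty; ∣_∣; inside; outside) renaming (_∈_ to _∈ˢ_)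
open import Data.Fin.Subset.Properties using (_∈?_; nonempty?; x∈p⇒∣p-x∣<∣p∣)
open import Data.List.Base using (List; []; _∷_; map; length; filter; concatMap; cartesianProduct; cartesianProductWith; deduplicate)
open import Data.List.Membership.Propositional using (_∈_; _∉_; lose)
open import Data.List.Membership.Propositional.Properties
  using (∈-cartesianProductWith⁺; ∈-cartesianProduct⁺; ∈-concatMap⁺; ∈-deduplicate⁺)
open import Data.List.Properties using (filter-none)
open import Data.List.Relation.Unary.All as All using (All; []; _∷_)
open import Data.List.Relation.Unary.Any using (here; there)
open import Data.List.Relation.Unary.AllPairs using ([]; _∷_)
open import Data.List.Relation.Unary.Unique.Propositional using (Unique)
open import Data.List.Relation.Unary.Unique.DecPropositional.Properties using (deduplicate-!)
open import Data.Nat.Base as ℕ using (ℕ; zero; suc; z≤n; s≤s)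
import Data.Nat.Properties as ℕ
open import Data.Product.Base using (Σ-syntax; _×_; _,_; proj₁; proj₂)
open import Data.Product.Properties using (≡-dec)
open import Data.Vec.Base using (Vec; []; _∷_; lookup)
open import Function.Base using (_∘_)
open import Relation.Binary.PropositionalEquality using (_≡_; _≢_; refl; sym; cong)
import Relation.Binary.Reasoning.Setoid as SetoidReasoning
open import Relation.Nullary.Decidable using (Dec; yes; no; recompute; _×-dec_; _→-dec_)
open import Relation.Nullary.Negation using (¬_; contradiction; contradiction-irr)
open import Relation.Unary using (Pred; Decidable)

-- Exhaustive lists of vectors, bounded words and subsets.

module _ {a} {A : Set a} (xs : List A) where

  vectors : ∀ n → List (Vec A n)
  vectors zero    = [] ∷ []
  vectors (suc n) = cartesianProductWith _∷_ xs (vectors n)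

  ∈-vectors : (∀ x → x ∈ xs) → ∀ {n} (v : Vec A n) → v ∈ vectors n
  ∈-vectors h []      = here refl
  ∈-vectors h (x ∷ v) = ∈-cartesianProductWith⁺ _∷_ (h x) (∈-vectors h v)

  lists≤ : ℕ → List (List A)
  lists≤ zero    = [] ∷ []
  lists≤ (suc n) = [] ∷ cartesianProductWith _∷_ xs (lists≤ n)

  ∈-lists≤ : (∀ x → x ∈ xs) → ∀ {n} (ys : List A) → length ys ℕ.≤ n → ys ∈ lists≤ n
  ∈-lists≤ h {zero}  []       _       = here refl
  ∈-lists≤ h {suc n} []       _       = here refl
  ∈-lists≤ h {suc n} (y ∷ ys) (s≤s p) = there (∈-cartesianProductWith⁺ _∷_ (h y) (∈-lists≤ h ys p))

subsets : ∀ n → List (Subset n)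
subsets = vectors (inside ∷ outside ∷ [])

∈-subsets : ∀ {n} (p : Subset n) → p ∈ subsets n
∈-subsets = ∈-vectors _ λ { inside → here refl ; outside → there (here refl) }

nonempty⇒1≤∣p∣ : ∀ {n} {p : Subset n} → Nonempty p → 1 ℕ.≤ ∣ p ∣
-- Removing `x` strictly lowers the cardinality, so `∣ p ∣` exceeds some natural number.
nonempty⇒1≤∣p∣ (_ , x∈p) = ℕ.≤-trans (s≤s z≤n) (x∈p⇒∣p-x∣<∣p∣ x∈p)

-- Finiteness of the connected subgraphs and of the support.

module _ (G : Graph) where
  open Graph G using (order; neighbours)
  open Subgraph using (vertices; edges; reachable?; IsConnected)
  open 𝒢 using (graph)

  private
    Raw : Set
    Raw = Subset order × Vec (Subset order) order

  -- The three laws of `Subgraph` in one formula, with explicit quantifiers over finite types so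
  -- that it can be decided.
  IsSubgraph : Raw → Set
  IsSubgraph (V , E) = ∀ x y → y ∈ˢ lookup E x → x ∈ˢ lookup E y × x ∈ˢ V × y ∈ˢ neighbours x

  isSubgraph? : ∀ r → Dec (IsSubgraph r)
  isSubgraph? (V , E) = Fin.all? λ x → Fin.all? λ y →
    (y ∈? lookup E x) →-dec ((x ∈? lookup E y) ×-dec ((x ∈? V) ×-dec (y ∈? neighbours x)))

  isConnected? : ∀ Γ → Dec (IsConnected {G = G} Γ)
  isConnected? Γ = Fin.all? λ x → Fin.all? λ y →
    (x ∈? vertices Γ) →-dec ((y ∈? vertices Γ) →-dec reachable? Γ x y)

  fromRaw : Raw → List (Subgraph G)
  fromRaw (V , E) with isSubgraph? (V , E)
  ... | no _  = []
  ... | yes h = record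
    { vertices  = V
    ; edges     = E
    ; edges-sym = λ m → proj₁ (h _ _ m)
    ; edges⊆V   = λ m → proj₁ (proj₂ (h _ _ m))
    ; edges⊆G   = λ m → proj₂ (proj₂ (h _ _ m))
    } ∷ []

  -- The laws of a subgraph are irrelevant fields, so the record rebuilt from its vertices and edges
  -- is definitionally `Γ`. In the other branch they serve only to derive a contradiction, which
  -- irrelevance permits.
  ∈-fromRaw : ∀ Γ → Γ ∈ fromRaw (vertices Γ , edges Γ)
  ∈-fromRaw Γ@record{ edges-sym = s ; edges⊆V = v ; edges⊆G = g } with isSubgraph? (vertices Γ , edges Γ)
  ... | yes _ = here refl
  ... | no ¬h = contradiction-irr (λ x y m → s m , v m , g m) ¬h

  subgraphs : List (Subgraph G)
  subgraphs = concatMap fromRaw (cartesianProduct (subsets order) (vectors (subsets order) order))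

  ∈-subgraphs : ∀ Γ → Γ ∈ subgraphs
  ∈-subgraphs Γ = ∈-concatMap⁺ fromRaw
    (lose (∈-cartesianProduct⁺ (∈-subsets (vertices Γ)) (∈-vectors _ ∈-subsets (edges Γ))) (∈-fromRaw Γ))

  fromSubgraph : Subgraph G → List (𝒢 G)
  fromSubgraph Γ with nonempty? (vertices Γ) | isConnected? Γ
  ... | yes p | yes q = record { graph = Γ ; nonempty = p ; connected = q } ∷ []
  ... | _     | _     = []

  ∈-fromSubgraph : ∀ Γ → Γ ∈ fromSubgraph (graph Γ)
  ∈-fromSubgraph Γ@record{ nonempty = p ; connected = q } with nonempty? (vertices (graph Γ)) | isConnected? (graph Γ)
  ... | yes _ | yes _ = here refl
  ... | no ¬p | _     = contradiction-irr p ¬p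
  ... | yes _ | no ¬q = contradiction-irr q ¬q

  connectedSubgraphs : List (𝒢 G)
  connectedSubgraphs = concatMap fromSubgraph subgraphs

  ∈-connectedSubgraphs : ∀ Γ → Γ ∈ connectedSubgraphs
  ∈-connectedSubgraphs Γ = ∈-concatMap⁺ fromSubgraph (lose (∈-subgraphs (graph Γ)) (∈-fromSubgraph Γ))

  length≤∣V∣ : ∀ F → length F ℕ.≤ ∣V_∣ G F
  length≤∣V∣ []      = z≤n
  length≤∣V∣ (Γ@record{ nonempty = p } ∷ F) =
    -- Nonemptiness of a factor is known only irrelevantly; decidability of `≤` turns the resulting
    -- bound into a usable proof.
    ℕ.+-mono-≤ (recompute (1 ℕ.≤? ∣ vertices (graph Γ) ∣) (nonempty⇒1≤∣p∣ p)) (length≤∣V∣ F)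

  -- The cut-off is on the number of factors, so words with more than `n` vertices may occur too.
  -- Deduplication gives uniqueness without an analysis of repetitions in the enumerations.
  words≤ : ℕ → List (M G)
  words≤ n = deduplicate (_≟ᴹ_ G) (lists≤ connectedSubgraphs n)

  words≤-unique : ∀ n → Unique (words≤ n)
  words≤-unique n = deduplicate-! (_≟ᴹ_ G) _

  ∈-words≤ : ∀ {n} F → ∣V_∣ G F ℕ.≤ n → F ∈ words≤ n
  ∈-words≤ F F≤n = ∈-deduplicate⁺ (_≟ᴹ_ G)
    (∈-lists≤ connectedSubgraphs ∈-connectedSubgraphs F (ℕ.≤-trans (length≤∣V∣ F) F≤n))

  -- Taking induced subgraphs on complementary vertex sets loses no vertex, so `F` has at most as
  -- many vertices as the two tensor factors of any term of its coproduct together. A single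
  -- occurrence would therefore put `F` in the list.
  ∉-words≤⇒occurrences≡0 : ∀ F₁ F₂ F → F ∉ words≤ (∣V_∣ G F₁ ℕ.+ ∣V_∣ G F₂) → occurrences G F₁ F₂ F ≡ 0
  ∉-words≤⇒occurrences≡0 F₁ F₂ F F∉ = cong length
    (filter-none (≡-dec (_≟ᴹ_ G) (_≟ᴹ_ G) (F₁ , F₂)) {Δ-terms G F} (All.tabulate λ { m refl → F∉ (∈-words≤ F (Δ-terms-size G F m)) }))

-- Linear maps out of a free module.

module _ {c ℓ} (k : CommutativeRing c ℓ) where
  open Linear k

  -- Elements of `Free X` are formal expressions, only their equality being quotiented, so induction
  -- on the expression suffices.
  linear-ext : ∀ {x b ℓb} {X : Set x} {B : Module k b ℓb} (f g : LinearMap (Free X) B) →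
               (∀ x → Module._≈ᴹ_ B (fun f (gen x)) (fun g (gen x))) →
               ∀ t → Module._≈ᴹ_ B (fun f t) (fun g t)
  linear-ext {B = B} f g h = go
    where
    open Module B
    go : ∀ t → fun f t ≈ᴹ fun g t
    go (gen x) = h x
    go 𝟘       = ≈ᴹ-trans (0ᴹ-homo f) (≈ᴹ-sym (0ᴹ-homo g))
    go (s ⊕ t) = ≈ᴹ-trans (+ᴹ-homo f s t) (≈ᴹ-trans (+ᴹ-cong (go s) (go t)) (≈ᴹ-sym (+ᴹ-homo g s t)))
    go (a · t) = ≈ᴹ-trans (*ₗ-homo f a t) (≈ᴹ-trans (*ₗ-cong k.refl (go t)) (≈ᴹ-sym (*ₗ-homo g a t)))

-- Values of the product and of the sum on a word.

module _ {c ℓ} (k : CommutativeRing c ℓ) (G : Graph) where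
  open Linear k
  open HopfDual k G
  open CommutativeRing k using (_≈_; _*_; 0#; 1#)
  open SetoidReasoning k.setoid
  open MonoidMult k.+-monoid renaming (_×_ to _×ᵏ_)

  δ-refl : ∀ F → δ F F ≈ 1#
  δ-refl F with _≟ᴹ_ G F F
  ... | yes _  = k.refl
  ... | no F≢F = contradiction refl F≢F

  δ-≢ : ∀ {F F′} → F ≢ F′ → δ F F′ ≈ 0#
  δ-≢ {F} {F′} F≢F′ with _≟ᴹ_ G F F′
  ... | yes F≡F′ = contradiction F≡F′ F≢F′
  ... | no _     = k.refl

  -- Turns a sum into a count: each summand satisfying `P` contributes `1#` and every other one
  -- `0#`.
  fun-∑-indicator : ∀ {a ℓa x p} {A : Module k a ℓa} {X : Set x} {P : Pred X p} (P? : Decidable P)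
                    (φ : LinearMap A 𝐤) (g : X → Module.Carrierᴹ A) →
                    (∀ {x} → P x → fun φ (g x) ≈ 1#) → (∀ {x} → ¬ P x → fun φ (g x) ≈ 0#) →
                    ∀ xs → fun φ (∑ A (map g xs)) ≈ length (filter P? xs) ×ᵏ 1#
  fun-∑-indicator P? φ g h₁ h₀ []       = 0ᴹ-homo φ
  fun-∑-indicator P? φ g h₁ h₀ (x ∷ xs) with P? x
  ... | yes px = k.trans (+ᴹ-homo φ _ _) (k.+-cong (h₁ px) (fun-∑-indicator P? φ g h₁ h₀ xs))
  ... | no ¬px = k.trans (+ᴹ-homo φ _ _)
    (k.trans (k.+-cong (h₀ ¬px) (fun-∑-indicator P? φ g h₁ h₀ xs)) (k.+-identityˡ _))

  δ*δ-≢ : ∀ {F₁ F₂ A B} → (F₁ , F₂) ≢ (A , B) → δ F₁ A * δ F₂ B ≈ 0#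
  δ*δ-≢ {F₁} {F₂} {A} {B} ≢AB with _≟ᴹ_ G F₁ A
  ... | no _     = k.zeroˡ _
  ... | yes refl = k.trans (k.*-congˡ (δ-≢ (≢AB ∘ cong (F₁ ,_)))) (k.zeroʳ _)

  -- By computation the left side is the form `Z F₁ ⊗ Z F₂` on the sum of the coproduct terms. On
  -- `A ⊗ᴹ B` this form is `δ F₁ A * δ F₂ B`, the indicator of the pair `(F₁ , F₂)`, so it counts
  -- occurrences.
  Z✶Z-gen : ∀ F₁ F₂ F → fun (form (Z F₁ ✶ Z F₂)) (gen F) ≈ occurrences G F₁ F₂ F ×ᵏ 1#
  Z✶Z-gen F₁ F₂ F = fun-∑-indicator (≡-dec (_≟ᴹ_ G) (_≟ᴹ_ G) (F₁ , F₂)) (form (Z F₁) ⊗ᴸ form (Z F₂))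
    (λ (A , B) → A ⊗ᴹ B)
    (λ { refl → k.trans (k.*-cong (δ-refl F₁) (δ-refl F₂)) (k.*-identityˡ 1#) })
    δ*δ-≢
    (Δ-terms G F)

  fun-·ℕ : ∀ n α x → fun (form (n ·ℕ α)) x ≈ n ×ᵏ fun (form α) x
  fun-·ℕ zero    α x = k.refl
  fun-·ℕ (suc n) α x = k.+-congˡ (fun-·ℕ n α x)

  0-multiple : ∀ n → n ×ᵏ 0# ≈ 0#
  0-multiple zero    = k.refl
  0-multiple (suc n) = k.trans (k.+-identityˡ _) (0-multiple n)

  module _ (n : M G → ℕ) (F : M G) where

    private
      ∑Z : List (M G) → H*
      ∑Z Fs = ∑* (map (λ F → n F ·ℕ Z F) Fs)

    ·ℕ-Z-≡ : fun (form (n F ·ℕ Z F)) (gen F) ≈ n F ×ᵏ 1#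
    ·ℕ-Z-≡ = k.trans (fun-·ℕ (n F) (Z F) (gen F)) (×-congʳ (n F) (δ-refl F))

    ·ℕ-Z-≢ : ∀ {F′} → F′ ≢ F → fun (form (n F′ ·ℕ Z F′)) (gen F) ≈ 0#
    ·ℕ-Z-≢ {F′} F′≢F = begin
      fun (form (n F′ ·ℕ Z F′)) (gen F) ≈⟨ fun-·ℕ (n F′) (Z F′) (gen F) ⟩
      n F′ ×ᵏ δ F′ F                    ≈⟨ ×-congʳ (n F′) (δ-≢ F′≢F) ⟩
      n F′ ×ᵏ 0#                        ≈⟨ 0-multiple (n F′) ⟩
      0#                                ∎

    ∑Z-∉ : ∀ Fs → F ∉ Fs → fun (form (∑Z Fs)) (gen F) ≈ 0#
    ∑Z-∉ []        _  = k.refl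
    ∑Z-∉ (F′ ∷ Fs) F∉ =
      k.trans (k.+-cong (·ℕ-Z-≢ (F∉ ∘ here ∘ sym)) (∑Z-∉ Fs (F∉ ∘ there))) (k.+-identityˡ 0#)

    ∑Z-∈ : ∀ {Fs} → Unique Fs → F ∈ Fs → fun (form (∑Z Fs)) (gen F) ≈ n F ×ᵏ 1#
    -- Uniqueness keeps `F` out of the tail, so its coefficient is collected exactly once.
    ∑Z-∈ {_ ∷ Fs} (F≢ ∷ _) (here refl) =
      k.trans (k.+-cong ·ℕ-Z-≡ (∑Z-∉ Fs λ F∈ → All.lookup F≢ F∈ refl)) (k.+-identityʳ _)
    ∑Z-∈ (F′≢ ∷ u) (there F∈) =
      k.trans (k.+-cong (·ℕ-Z-≢ (All.lookup F′≢ F∈)) (∑Z-∈ u F∈)) (k.+-identityˡ _)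

theorem3p7 : ∀ {c ℓ} (k : CommutativeRing c ℓ) (G : Graph) (F₁ F₂ : M G) →
    let open HopfDual k G in
    Σ[ supp ∈ List (M G) ]
    Unique supp ×
    (∀ F → F ∉ supp → occurrences G F₁ F₂ F ≡ 0) ×
    Z F₁ ✶ Z F₂ ≈* ∑* (map (λ F → occurrences G F₁ F₂ F ·ℕ Z F) supp)
theorem3p7 k G F₁ F₂ = supp , words≤-unique G N , n-∉ ,
  linear-ext k (form (Z F₁ ✶ Z F₂)) (form (∑* (map (λ F → n F ·ℕ Z F) supp)))
    λ F → k.trans (Z✶Z-gen k G F₁ F₂ F) (k.sym (∑Z-value F (F ∈ᴹ? supp)))
  where
  open HopfDual k G
  open Linear k
  open import Data.List.Membership.DecPropositional (_≟ᴹ_ G) using () renaming (_∈?_ to _∈ᴹ?_)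
  open RawMonoidDefs k.+-rawMonoid using () renaming (_×_ to _×ᵏ_)

  N : ℕ
  N = ∣V_∣ G F₁ ℕ.+ ∣V_∣ G F₂

  supp : List (M G)
  supp = words≤ G N

  n : M G → ℕ
  n = occurrences G F₁ F₂

  n-∉ : ∀ F → F ∉ supp → n F ≡ 0
  n-∉ = ∉-words≤⇒occurrences≡0 G F₁ F₂

  ∑Z-value : ∀ F → Dec (F ∈ supp) →
             fun (form (∑* (map (λ F → n F ·ℕ Z F) supp))) (gen F) k.≈ n F ×ᵏ k.1#
  ∑Z-value F (yes F∈) = ∑Z-∈ k G n F (words≤-unique G N) F∈
  -- Off the support no summand sees `F`, and the expected value vanishes as well because `n F` is
  -- zero.
  ∑Z-value F (no F∉)  = k.trans (∑Z-∉ k G n F supp F∉)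
    (k.sym (k.reflexive (cong (_×ᵏ k.1#) (n-∉ F F∉))))
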